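{- Let $n,k$ be integers with $n\ge k+1$, let $N=\{1,\dots,n\}$, and let $R\subseteq N$ with $|R|=r>1$. (1) If $k\le2$, then $R$ is a successful coalition. (2) If $k\ge3$, then $R$ is not a successful coalition.
   Context: Each $i\in N$ chooses a set $S_i\subseteq N$ with $|S_i|=k$ and $i\notin S_i$. Given such choices $S_1,\dots,S_n$, an admissible partition is a partition of $N$ into pairwise disjoint parts such that for every part $N_i$ and every $j\in N_i$ we have $S_j\cap N_i\ne\emptyset$. A set $R\subseteq N$ is a successful coalition if there are choices of sets $S_i$ for $i\in R$ (with $|S_i|=k$, $i\notin S_i$) such that for any choices of sets $S_j$ ($|S_j|=k$, $j\notin S_j$) for all $j\in N\setminus R$, and for any admissible partition of $N$ with respect to $S_1,\dots,S_n$, all elements of $R$ lie in the same part. -}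

module Defs where

open import Data.Nat using (ℕ)
open import Data.Fin using (Fin)
open import Data.Fin.Subset using (Subset; _∈_; _∉_; ∣_∣)
open import Data.Fin.Subset.Properties using (_∈?_)
open import Data.Product using (Σ; ∃; _×_; _,_; proj₁)
open import Relation.Binary.PropositionalEquality using (_≡_)
open import Relation.Nullary using (yes; no)

Choice : (n k : ℕ) → Fin n → Set
Choice n k i = Σ (Subset n) (λ S → (∣ S ∣ ≡ k) × (i ∉ S))

Profile : (n k : ℕ) → Set
Profile n k = (i : Fin n) → Choice n k i

chosen : ∀ {n k} → Profile n k → Fin n → Subset n
chosen σ i = proj₁ (σ i)

combine : ∀ {n k} → Subset n → Profile n k → Profile n k → Profile n k
combine R σR σO i with i ∈? R
... | yes _ = σR i
... | no  _ = σO i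

-- A partition of N is given by a labelling of the elements by part labels;
-- the parts are the (nonempty) fibres. Every partition of an n-element set
-- has at most n parts, so labels in Fin n describe all partitions.
Partition : ℕ → Set
Partition n = Fin n → Fin n

Admissible : ∀ {n} → (Fin n → Subset n) → Partition n → Set
Admissible {n} S p = (j : Fin n) → ∃ λ l → (l ∈ S j) × (p l ≡ p j)

SamePart : ∀ {n} → Subset n → Partition n → Set
SamePart {n} R p = (i j : Fin n) → i ∈ R → j ∈ R → p i ≡ p j

-- R is a successful coalition: there are choices for members of R such that,
-- for any choices of the non-members, every admissible partition keeps R in one part.
-- (Choices of σR outside R and of σO inside R are irrelevant because of `combine`.)
SuccessfulCoalition : (n k : ℕ) → Subset n → Set
SuccessfulCoalition n k R =
  ∃ λ (σR : Profile n k) → (σO : Profile n k) → (p : Partition n) →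
    Admissible (chosen (combine R σR σO)) p → SamePart R p

{-# OPTIONS --safe #-}
-- For k ≤ 2, two members a and b of R are tied to each other (through a third
-- element c when k = 2), and every other member only chooses among a and b.
--
-- For k ≥ 3 and |R| < k, the outsiders choose supersets of R, and {a , c} can be
-- split off, where a ∈ R and c ∉ R is chosen by a.  For |R| ≥ k, the outsiders
-- choose subsets of R, so every part of an admissible partition meets R, and it
-- suffices to split N into two nonempty parts.  This is Thomassen's theorem that
-- a digraph of minimum outdegree 3 has two disjoint cycles.  In a minimal
-- counterexample there are no cycles of length ≤ 2, and the ends of each arc have
-- a common in-neighbour (else contract the arc).  Let C be a minimal set in which
-- every vertex has an out-neighbour.  The rest is acyclic, and one finds its
-- first vertices u, w, x in a topological order.  All of C dominates u and w, so
-- outdegree 3 leaves no arc from C to x, and the in-neighbours of x, which lie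
-- in {u , w}, cannot each have an in-neighbour among themselves.
module Submission where

open import Defs
open import Data.Nat using (ℕ; zero; suc; _≤_; _≥_; _<_; z≤n; s≤s; _∸_)
import Data.Nat.Properties as ℕ
import Data.Empty as Empty
open import Data.Fin using (Fin; zero; suc; punchIn; punchOut; _≟_)
open import Data.Fin.Properties using (any?; suc-injective; injective⇒≤;
  punchOut-cong; punchOut-injective; punchOut-punchIn; punchIn-punchOut; punchInᵢ≢i)
open import Data.Fin.Subset using (Subset; ∣_∣; _∈_; _∉_; _⊆_; _⊂_; _⊃_; ∁; _∪_; ⁅_⁆;
  Nonempty; inside; outside; ⊥; ⊤)
open import Data.Fin.Subset.Induction using (⊂-wellFounded; ⊃-wellFounded; Acc; acc)
open import Data.Fin.Subset.Properties
open import Data.Product using (∃; _×_; _,_; proj₁; proj₂)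
open import Data.Sum using (_⊎_; inj₁; inj₂; [_,_]′)
open import Data.Vec using (Vec; []; _∷_; lookup; tabulate; here; there)
open import Data.Vec.Properties using ([]=⇒lookup; lookup⇒[]=; lookup∘tabulate)
import Data.Vec.Relation.Unary.All as All
open import Data.Vec.Relation.Unary.All.Properties using (lookup⁺)
open import Data.Vec.Relation.Unary.AllPairs using ([]; _∷_)
open import Data.Vec.Relation.Unary.Unique.Propositional using (Unique)
open import Data.Vec.Relation.Unary.Unique.Propositional.Properties using (lookup-injective)
open import Function using (_∘_; flip; case_of_)
open import Function.Definitions using (Injective)
open import Level using (0ℓ)
import Relation.Binary as B
open import Relation.Binary using (Rel)
open import Relation.Binary.PropositionalEquality
  using (_≡_; _≢_; refl; sym; trans; cong; subst; ≢-sym)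
open import Relation.Nullary using (¬_; yes; no; does; contradiction; ¬?)
open import Relation.Nullary.Decidable using (_×-dec_; _⊎-dec_; decidable-stable; dec-true)
open import Relation.Unary using (Pred; Decidable)

private
  variable
    k m n : ℕ
    A : Set

Inj : (Fin m → A) → Set
Inj = Injective _≡_ _≡_

-- Finite sets

select : {P : Pred (Fin n) 0ℓ} → Decidable P → Subset n
select P? = tabulate (does ∘ P?)

module _ {P : Pred (Fin n) 0ℓ} (P? : Decidable P) where

  ∈-select⁺ : ∀ {x} → P x → x ∈ select P?
  ∈-select⁺ {x} px =
    lookup⇒[]= x _ (trans (lookup∘tabulate (does ∘ P?) x) (dec-true (P? x) px))

  ∈-select⁻ : ∀ {x} → x ∈ select P? → P x
  ∈-select⁻ {x} x∈ with P? x | trans (sym (lookup∘tabulate (does ∘ P?) x)) ([]=⇒lookup x∈)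
  ... | yes px | _ = px

  ∉-select⁺ : ∀ {x} → ¬ P x → x ∈ ∁ (select P?)
  ∉-select⁺ ¬px = x∉p⇒x∈∁p (¬px ∘ ∈-select⁻)

  ∉-select⁻ : ∀ {x} → x ∈ ∁ (select P?) → ¬ P x
  ∉-select⁻ x∈ = x∈∁p⇒x∉p x∈ ∘ ∈-select⁺

covered⇒≤ : (f : Fin m → A) (g : Fin k → A) → Inj g → (∀ j → ∃ λ i → f i ≡ g j) → k ≤ m
covered⇒≤ f g g-inj cover = injective⇒≤ λ {j} {j′} eq →
  g-inj (trans (sym (proj₂ (cover j))) (trans (cong f eq) (proj₂ (cover j′))))

avoid-two : (g : Fin 3 → Fin n) → Inj g → ∀ x y → ∃ λ j → g j ≢ x × g j ≢ y
avoid-two g g-inj x y with any? (λ j → ¬? (g j ≟ x) ×-dec ¬? (g j ≟ y))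
... | yes found = found
... | no none = contradiction (covered⇒≤ (lookup (x ∷ y ∷ [])) g g-inj cover) λ { (s≤s (s≤s ())) }
  where
  cover : ∀ j → ∃ λ i → lookup (x ∷ y ∷ []) i ≡ g j
  cover j with g j ≟ x | g j ≟ y
  ... | yes eq | _      = zero , sym eq
  ... | no _   | yes eq = suc zero , sym eq
  ... | no ≢x  | no ≢y  = contradiction (j , ≢x , ≢y) none

enumerate : (p : Subset n) → m ≤ ∣ p ∣ → ∃ λ (f : Fin m → Fin n) → Inj f × (∀ i → f i ∈ p)
enumerate {m = zero} p _ = (λ ()) , (λ { {()} }) , λ ()
enumerate {m = suc _} (outside ∷ p) m≤ =
  let f , f-inj , f∈ = enumerate p m≤
  in suc ∘ f , f-inj ∘ suc-injective , there ∘ f∈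
enumerate {n = suc n} {m = suc m} (inside ∷ p) (s≤s m≤) = g , g-inj , g∈
  where
  f = proj₁ (enumerate p m≤)
  f-inj = proj₁ (proj₂ (enumerate p m≤))
  g : Fin (suc m) → Fin (suc n)
  g zero = zero
  g (suc i) = suc (f i)
  g-inj : Inj g
  g-inj {zero} {zero} _ = refl
  g-inj {suc i} {suc j} eq = cong suc (f-inj (suc-injective eq))
  g∈ : ∀ i → g i ∈ inside ∷ p
  g∈ zero = here
  g∈ (suc i) = there (proj₂ (proj₂ (enumerate p m≤)) i)

avoid-two-in : (p : Subset n) → 3 ≤ ∣ p ∣ → ∀ x y → ∃ λ z → z ∈ p × z ≢ x × z ≢ y
avoid-two-in p 3≤ x y =
  let f , f-inj , f∈ = enumerate p 3≤
      i , ≢x , ≢y = avoid-two f f-inj x y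
  in f i , f∈ i , ≢x , ≢y

∣q∣<∣p∣⇒p⊈q : (p q : Subset n) → ∣ q ∣ < ∣ p ∣ → ∃ λ x → x ∈ p × x ∉ q
∣q∣<∣p∣⇒p⊈q p q q<p with any? (λ x → (x ∈? p) ×-dec ¬? (x ∈? q))
... | yes found = found
... | no none = contradiction
  (p⊆q⇒∣p∣≤∣q∣ λ {x} x∈p → decidable-stable (x ∈? q) λ x∉q → none (x , x∈p , x∉q))
  (ℕ.<⇒≱ q<p)

-- Supplies the outsiders' choices: a `k`-subset of `R`, or a `k`-superset of `R` that avoids the
-- chooser.
interpolate : (p q : Subset n) → p ⊆ q → ∣ p ∣ ≤ k → k ≤ ∣ q ∣ →
  ∃ λ s → p ⊆ s × s ⊆ q × ∣ s ∣ ≡ k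
interpolate [] [] _ _ z≤n = [] , (λ ()) , (λ ()) , refl
interpolate (inside ∷ p) (outside ∷ q) p⊆q _ _ = case p⊆q here of λ ()
interpolate (inside ∷ p) (inside ∷ q) p⊆q (s≤s p≤) (s≤s ≤q) =
  let s , p⊆s , s⊆q , eq = interpolate p q (drop-∷-⊆ p⊆q) p≤ ≤q
  in inside ∷ s , in⊆in p⊆s , in⊆in s⊆q , cong suc eq
interpolate (outside ∷ p) (outside ∷ q) p⊆q p≤ ≤q =
  let s , p⊆s , s⊆q , eq = interpolate p q (drop-∷-⊆ p⊆q) p≤ ≤q
  in outside ∷ s , out⊆ p⊆s , out⊆ s⊆q , eq
interpolate {k = k} (outside ∷ p) (inside ∷ q) p⊆q p≤ ≤q with k ℕ.≤? ∣ q ∣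
... | yes ≤q′ =
  let s , p⊆s , s⊆q , eq = interpolate p q (drop-∷-⊆ p⊆q) p≤ ≤q′
  in outside ∷ s , out⊆ p⊆s , out⊆ s⊆q , eq
-- Here `k` exceeds the size of `q`, so it equals that of `inside ∷ q` and everything is taken.
... | no ≰q = inside ∷ q , out⊆ (drop-∷-⊆ p⊆q) , ⊆-refl , ℕ.≤-antisym (ℕ.≰⇒> ≰q) ≤q

∣⁅x⁆∪⁅y⁆∣≡2 : {x y : Fin n} → x ≢ y → ∣ ⁅ x ⁆ ∪ ⁅ y ⁆ ∣ ≡ 2
∣⁅x⁆∪⁅y⁆∣≡2 {x = zero} {zero} x≢y = contradiction refl x≢y
∣⁅x⁆∪⁅y⁆∣≡2 {x = zero} {suc y} _ =
  cong suc (trans (cong ∣_∣ (∪-identityˡ ⁅ y ⁆)) (∣⁅x⁆∣≡1 y))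
∣⁅x⁆∪⁅y⁆∣≡2 {x = suc x} {zero} _ =
  cong suc (trans (cong ∣_∣ (∪-identityʳ ⁅ x ⁆)) (∣⁅x⁆∣≡1 x))
∣⁅x⁆∪⁅y⁆∣≡2 {x = suc x} {suc y} x≢y = ∣⁅x⁆∪⁅y⁆∣≡2 (x≢y ∘ cong suc)

minimal : {P : Pred (Subset n) 0ℓ} → Decidable P → ∀ {A} → P A →
  ∃ λ M → P M × (∀ {B} → B ⊆ M → P B → M ⊆ B)
minimal {n} {P} P? {A} = go (⊂-wellFounded A)
  where
  go : ∀ {A} → Acc _⊂_ A → P A → ∃ λ M → P M × (∀ {B} → B ⊆ M → P B → M ⊆ B)
  go {A} (acc rec) pA with anySubset? (λ B → (B ⊂? A) ×-dec P? B)
  ... | yes (B , B⊂A , pB) = go (rec B⊂A) pB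
  ... | no none = A , pA , λ {B} B⊆A pB {x} x∈A →
    decidable-stable (x ∈? B) λ x∉B → none (B , (B⊆A , x , x∈A , x∉B) , pB)

-- Sets of vertices containing a cycle

Closed : Rel (Fin n) 0ℓ → Subset n → Set
Closed _⟶_ A = ∀ {x} → x ∈ A → ∃ λ y → y ∈ A × x ⟶ y

-- By finiteness, following arcs inside such a set leads to a cycle, and the vertices of a cycle
-- form such a set. Cycles can thus be handled as sets.
Cyclic : Rel (Fin n) 0ℓ → Subset n → Set
Cyclic _⟶_ A = Nonempty A × Closed _⟶_ A

Split : Rel (Fin n) 0ℓ → Set
Split _⟶_ = ∃ λ A → Cyclic _⟶_ A × Cyclic _⟶_ (∁ A)

module _ {_⟶_ : Rel (Fin n) 0ℓ} (_⟶?_ : B.Decidable _⟶_) where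

  closed-or-sink : ∀ A → Closed _⟶_ A ⊎ ∃ λ x → x ∈ A × (∀ {y} → y ∈ A → ¬ x ⟶ y)
  closed-or-sink A with any? (λ x → (x ∈? A) ×-dec ¬? (any? (λ y → (y ∈? A) ×-dec (x ⟶? y))))
  ... | yes (x , x∈A , sink) = inj₂ (x , x∈A , λ {y} y∈A x⟶y → sink (y , y∈A , x⟶y))
  ... | no none = inj₁ λ {x} x∈A →
    decidable-stable (any? (λ y → (y ∈? A) ×-dec (x ⟶? y))) λ sink → none (x , x∈A , sink)

  cyclic? : Decidable (Cyclic _⟶_)
  cyclic? A with nonempty? A | closed-or-sink A
  ... | no empty | _ = no (empty ∘ proj₁)
  ... | yes ne | inj₁ cl = yes (ne , cl)
  ... | yes ne | inj₂ (x , x∈A , sink) = no λ (_ , cl) →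
    let y , y∈A , x⟶y = cl x∈A in sink y∈A x⟶y

  -- Removing a sink keeps the property that all vertices have in-neighbours.
  coclosed⇒cyclic : ∀ {A} → Nonempty A → Closed (flip _⟶_) A → ∃ λ B → B ⊆ A × Cyclic _⟶_ B
  coclosed⇒cyclic {A} = go (⊂-wellFounded A)
    where
    go : ∀ {A} → Acc _⊂_ A → Nonempty A → Closed (flip _⟶_) A → ∃ λ B → B ⊆ A × Cyclic _⟶_ B
    go {A} (acc rec) ne co with closed-or-sink A
    ... | inj₁ cl = A , ⊆-refl , ne , cl
    ... | inj₂ (s , s∈A , sink) =
      let B , B⊆ , cyc = go (rec A′⊂A) ne′ co′ in B , proj₁ ∘ ∈-select⁻ P? ∘ B⊆ , cyc
      where
      P? : Decidable (λ x → x ∈ A × x ≢ s)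
      P? x = (x ∈? A) ×-dec ¬? (x ≟ s)
      A′ = select P?
      A′⊂A : A′ ⊂ A
      A′⊂A = (proj₁ ∘ ∈-select⁻ P?) , s , s∈A , λ s∈A′ → proj₂ (∈-select⁻ P? s∈A′) refl
      pred : ∀ {y} → y ∈ A → ∃ λ x → x ∈ A′ × x ⟶ y
      pred y∈A = let x , x∈A , x⟶y = co y∈A in
        x , ∈-select⁺ P? (x∈A , λ { refl → sink y∈A x⟶y }) , x⟶y
      -- `s` has an in-neighbour in `A`, and a sink is not its own in-neighbour.
      ne′ : Nonempty A′
      ne′ = let x , x∈A′ , _ = pred s∈A in x , x∈A′
      co′ : Closed (flip _⟶_) A′
      co′ = pred ∘ proj₁ ∘ ∈-select⁻ P?

  -- `A` absorbs vertices outside `B` that have an arc into it, which keeps it cyclic. Once this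
  -- stops, vertices outside both sets have all their out-neighbours outside `A`, so the complement
  -- is closed.
  disjoint-cyclic⇒split : (∀ x → ∃ λ y → x ⟶ y) →
    ∀ {A B} → B ⊆ ∁ A → Cyclic _⟶_ A → Cyclic _⟶_ B → Split _⟶_
  disjoint-cyclic⇒split succ {A} {B} B⊆∁A cycA ((b , b∈B) , clB) = go (⊃-wellFounded A) B⊆∁A cycA
    where
    go : ∀ {A} → Acc _⊃_ A → B ⊆ ∁ A → Cyclic _⟶_ A → Split _⟶_
    go {A} (acc rec) B⊆∁A (ne , cl)
      with any? (λ z → ¬? (z ∈? A) ×-dec ¬? (z ∈? B) ×-dec any? (λ y → (y ∈? A) ×-dec (z ⟶? y)))
    ... | no none = A , (ne , cl) , (b , B⊆∁A b∈B) , cl∁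
      where
      cl∁ : Closed _⟶_ (∁ A)
      cl∁ {x} x∈∁A with x ∈? B
      ... | yes x∈B = let y , y∈B , x⟶y = clB x∈B in y , B⊆∁A y∈B , x⟶y
      ... | no x∉B = let y , x⟶y = succ x in
        y , x∉p⇒x∈∁p (λ y∈A → none (x , x∈∁p⇒x∉p x∈∁A , x∉B , y , y∈A , x⟶y)) , x⟶y
    ... | yes (z , z∉A , z∉B , y , y∈A , z⟶y) = go (rec A⊂A′) B⊆∁A′ (ne′ , cl′)
      where
      A′ = A ∪ ⁅ z ⁆
      A⊆A′ : A ⊆ A′
      A⊆A′ = p⊆p∪q ⁅ z ⁆
      A⊂A′ : A ⊂ A′
      A⊂A′ = A⊆A′ , z , q⊆p∪q A ⁅ z ⁆ (x∈⁅x⁆ z) , z∉A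
      B⊆∁A′ : B ⊆ ∁ A′
      B⊆∁A′ {x} x∈B = x∉p⇒x∈∁p λ x∈A′ → case x∈p∪q⁻ A ⁅ z ⁆ x∈A′ of λ where
        (inj₁ x∈A) → x∈∁p⇒x∉p (B⊆∁A x∈B) x∈A
        (inj₂ x∈z) → z∉B (subst (_∈ B) (x∈⁅y⁆⇒x≡y z x∈z) x∈B)
      ne′ : Nonempty A′
      ne′ = let x , x∈A = ne in x , A⊆A′ x∈A
      cl′ : Closed _⟶_ A′
      cl′ {x} x∈A′ with x∈p∪q⁻ A ⁅ z ⁆ x∈A′
      ... | inj₁ x∈A = let y , y∈A , x⟶y = cl x∈A in y , A⊆A′ y∈A , x⟶y
      ... | inj₂ x∈z = y , A⊆A′ y∈A , subst (_⟶ y) (sym (x∈⁅y⁆⇒x≡y z x∈z)) z⟶y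

-- Thomassen's theorem

Arc : (Fin n → Fin 3 → Fin n) → Rel (Fin n) 0ℓ
Arc out x y = ∃ λ i → out x i ≡ y

arc? : (out : Fin n → Fin 3 → Fin n) → B.Decidable (Arc out)
arc? out x y = any? λ i → out x i ≟ y

module _ (out : Fin n → Fin 3 → Fin n) (out-inj : ∀ z → Inj (out z)) where

  private
    _⟶_ = Arc out

  -- Out-degree 3 gives every vertex an out-neighbour other than `x` and `y`, so the complement is
  -- cyclic. The case `x ≡ y` is included and covers loops.
  two-cycle⇒split : ∀ {x y} → x ⟶ y → y ⟶ x → Split _⟶_
  two-cycle⇒split {x} {y} x⟶y y⟶x =
    select P? ,
    ((x , ∈-select⁺ P? (inj₁ refl)) , λ z∈ → case ∈-select⁻ P? z∈ of λ where
      (inj₁ refl) → y , ∈-select⁺ P? (inj₂ refl) , x⟶y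
      (inj₂ refl) → x , ∈-select⁺ P? (inj₁ refl) , y⟶x) ,
    (let v , v∈ , _ = leave x in v , v∈) , λ {z} _ → leave z
    where
    P? : Decidable (λ z → z ≡ x ⊎ z ≡ y)
    P? z = (z ≟ x) ⊎-dec (z ≟ y)
    leave : ∀ z → ∃ λ v → v ∈ ∁ (select P?) × z ⟶ v
    leave z = let i , ≢x , ≢y = avoid-two (out z) (out-inj z) x y in
      out z i , ∉-select⁺ P? [ ≢x , ≢y ]′ , i , refl

  -- Cyclic sets of the rest would split the digraph, so `unsplit` lets us treat
  -- the complement of C as acyclic.
  common-in-neighbours⇒split :
    Fin n → (∀ {x y} → x ⟶ y → ¬ y ⟶ x) →
    (∀ {x y} → x ⟶ y → ∃ λ z → z ⟶ x × z ⟶ y) →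
    ¬ ¬ Split _⟶_
  common-in-neighbours⇒split v₀ asym common unsplit
    with minimal (cyclic? (arc? out)) {A = ⊤}
           ((v₀ , ∈⊤) , λ {x} _ → out x zero , ∈⊤ , zero , refl)
  ... | C , cycC@((c , c∈C) , clC) , minC = u-step
    where
    succ : ∀ x → x ⟶ out x zero
    succ x = zero , refl

    in-neighbour : ∀ x → ∃ λ z → z ⟶ x
    in-neighbour x = let z , z⟶x , _ = common (succ x) in z , z⟶x

    -- If every vertex in `P` had an in-neighbour in `P`, these vertices would contain a cyclic set
    -- disjoint from `C`, and the digraph would split.
    source : {P : Pred (Fin n) 0ℓ} → Decidable P → (∀ {z} → P z → z ∉ C) → ∃ P →
      ∃ λ x → P x × (∀ {z} → P z → ¬ z ⟶ x)
    source P? P⇒∉C (y , py) with closed-or-sink (flip (arc? out)) (select P?)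
    ... | inj₂ (x , x∈ , min) = x , ∈-select⁻ P? x∈ , min ∘ ∈-select⁺ P?
    ... | inj₁ co =
      let B , B⊆ , cycB = coclosed⇒cyclic (arc? out) (y , ∈-select⁺ P? py) co
      in contradiction
        (disjoint-cyclic⇒split (arc? out) (λ x → _ , succ x)
          (x∉p⇒x∈∁p ∘ P⇒∉C ∘ ∈-select⁻ P? ∘ B⊆) cycC cycB)
        unsplit

    -- For each in-neighbour `y` of `x` in `C`, a common in-neighbour of `y` and `x` is again one,
    -- as `stays` keeps it in `C`. Hence these vertices contain a cyclic set, which is all of `C` by
    -- minimality.
    dominates : ∀ {x} → (∃ λ z → z ∈ C × z ⟶ x) →
      (∀ {y z} → y ∈ C → y ⟶ x → z ⟶ y → z ⟶ x → z ∈ C) →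
      ∀ {c} → c ∈ C → c ⟶ x
    dominates {x} (z , z∈C , z⟶x) stays c∈C =
      let B , B⊆ , cycB = coclosed⇒cyclic (arc? out) (z , ∈-select⁺ P? (z∈C , z⟶x)) co
      in proj₂ (∈-select⁻ P? (B⊆ (minC (proj₁ ∘ ∈-select⁻ P? ∘ B⊆) cycB c∈C)))
      where
      P? : Decidable (λ z → z ∈ C × z ⟶ x)
      P? z = (z ∈? C) ×-dec arc? out z x
      co : Closed (flip _⟶_) (select P?)
      co y∈ = let y∈C , y⟶x = ∈-select⁻ P? y∈
                  z , z⟶y , z⟶x = common y⟶x
              in z , ∈-select⁺ P? (stays y∈C y⟶x z⟶y z⟶x , z⟶x) , z⟶y

    irrefl : ∀ {x y} → x ⟶ y → x ≢ y
    irrefl x⟶y refl = asym x⟶y x⟶y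

    -- If `C` were everything, `dominates` would apply to `c` itself and give a loop.
    outside-C : ∃ λ z → z ∉ C
    outside-C with any? (λ z → ¬? (z ∈? C))
    ... | yes found = found
    ... | no none = contradiction refl (irrefl (dominates (z , ∈C z , z⟶c) (λ {_} {z} _ _ _ _ → ∈C z) c∈C))
      where
      ∈C : ∀ z → z ∈ C
      ∈C z = decidable-stable (z ∈? C) λ z∉C → none (z , z∉C)
      z = proj₁ (in-neighbour c)
      z⟶c = proj₂ (in-neighbour c)

    u-step : Empty.⊥
    u-step with source (λ z → ¬? (z ∈? C)) (λ z∉C → z∉C) outside-C
    ... | u , u∉C , u-source = w-step
      where
      in-u : ∀ {z} → z ⟶ u → z ∈ C
      in-u {z} z⟶u = decidable-stable (z ∈? C) λ z∉C → u-source z∉C z⟶u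

      C⟶u : ∀ {c} → c ∈ C → c ⟶ u
      C⟶u = let z , z⟶u = in-neighbour u in
        dominates (z , in-u z⟶u , z⟶u) λ _ _ _ → in-u

      out-u : ∀ {z} → u ⟶ z → z ∉ C
      out-u u⟶z z∈C = asym u⟶z (C⟶u z∈C)

      w-step : Empty.⊥
      -- No arc leads from `u` into `C`, so an out-neighbour of `u` is a vertex outside `C` other
      -- than `u`.
      w-step with source (λ z → ¬? (z ∈? C) ×-dec ¬? (z ≟ u)) proj₁
                    (out u zero , out-u (succ u) , ≢-sym (irrefl (succ u)))
      ... | w , (w∉C , w≢u) , w-source = x-step
        where
        in-w : ∀ {z} → z ⟶ w → z ≢ u → z ∈ C
        in-w {z} z⟶w z≢u = decidable-stable (z ∈? C) λ z∉C → w-source (z∉C , z≢u) z⟶w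

        C-in-w : ∃ λ z → z ∈ C × z ⟶ w
        C-in-w with in-neighbour w
        ... | z , z⟶w with z ≟ u
        ...   | no z≢u = z , in-w z⟶w z≢u , z⟶w
        -- All in-neighbours of `u` lie in `C`, in particular one that it shares with `w`.
        ...   | yes refl = let z′ , z′⟶u , z′⟶w = common z⟶w in z′ , in-u z′⟶u , z′⟶w

        C⟶w : ∀ {c} → c ∈ C → c ⟶ w
        -- The only in-neighbour of `w` that could lie outside `C` is `u`, which has no arc to
        -- `y ∈ C`.
        C⟶w = dominates C-in-w λ y∈C _ z⟶y z⟶w →
          in-w z⟶w λ { refl → out-u z⟶y y∈C }

        x-step : Empty.⊥
        x-step with source (λ z → ¬? (z ∈? C) ×-dec ¬? (z ≟ u) ×-dec ¬? (z ≟ w)) proj₁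
                      (let i , ≢u , ≢w = avoid-two (out u) (out-inj u) u w in
                       out u i , out-u (i , refl) , ≢u , ≢w)
        ... | x , (x∉C , x≢u , x≢w) , x-source =
          -- Both `z` and the common in-neighbour `z′` of `z` and `x` must be `w`, which makes a
          -- loop.
          let z , z⟶x = in-neighbour x
              z′ , z′⟶z , z′⟶x = common z⟶x
          in irrefl z′⟶z (trans (only-w z′⟶x) (sym (only-w z⟶x)))
          where
          -- Otherwise `c` would have four distinct out-neighbours: some `d` in `C`, and `u`, `w`,
          -- `x`.
          C↛x : ∀ {c} → c ∈ C → ¬ c ⟶ x
          C↛x {c} c∈C c⟶x =
            let d , d∈C , c⟶d = clC c∈C
                ∈≢∉ : ∀ {z} → z ∉ C → d ≢ z
                ∈≢∉ z∉C = λ { refl → z∉C d∈C }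
                distinct : Unique (d ∷ u ∷ w ∷ x ∷ [])
                distinct = (∈≢∉ u∉C All.∷ ∈≢∉ w∉C All.∷ ∈≢∉ x∉C All.∷ All.[])
                  ∷ (≢-sym w≢u All.∷ ≢-sym x≢u All.∷ All.[])
                  ∷ (≢-sym x≢w All.∷ All.[]) ∷ All.[] ∷ []
                hit : All.All (c ⟶_) (d ∷ u ∷ w ∷ x ∷ [])
                hit = c⟶d All.∷ C⟶u c∈C All.∷ C⟶w c∈C All.∷ c⟶x All.∷ All.[]
            in case covered⇒≤ (out c) (lookup (d ∷ u ∷ w ∷ x ∷ []))
                      (λ {i} {j} → lookup-injective distinct i j) (λ j → lookup⁺ hit j)
               of λ { (s≤s (s≤s (s≤s ()))) }

          in-x : ∀ {z} → z ⟶ x → z ≡ u ⊎ z ≡ w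
          in-x {z} z⟶x with z ≟ u | z ≟ w
          ... | yes z≡u | _ = inj₁ z≡u
          ... | no _ | yes z≡w = inj₂ z≡w
          ... | no z≢u | no z≢w =
            contradiction z⟶x (x-source ((λ z∈C → C↛x z∈C z⟶x) , z≢u , z≢w))

          -- A common in-neighbour of `u` and `x` would lie in `C`, against `C↛x`.
          u↛x : ¬ u ⟶ x
          u↛x u⟶x = let z , z⟶u , z⟶x = common u⟶x in C↛x (in-u z⟶u) z⟶x

          only-w : ∀ {z} → z ⟶ x → z ≡ w
          only-w z⟶x with in-x z⟶x
          ... | inj₁ refl = contradiction z⟶x u↛x
          ... | inj₂ z≡w = z≡w

-- Contraction of an arc

module Contraction (out : Fin (suc n) → Fin 3 → Fin (suc n)) {x y : Fin (suc n)} (x≢y : x ≢ y) where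

  π : Fin (suc n) → Fin n
  π z with x ≟ z
  ... | yes _ = punchOut x≢y
  ... | no x≢z = punchOut x≢z

  π-≢ : ∀ {z} (x≢z : x ≢ z) → π z ≡ punchOut x≢z
  π-≢ {z} x≢z with x ≟ z
  ... | yes x≡z = contradiction x≡z x≢z
  ... | no _ = punchOut-cong x refl

  π-x : π x ≡ punchOut x≢y
  π-x with x ≟ x
  ... | yes _ = refl
  ... | no x≢x = contradiction refl x≢x

  π-punchIn : ∀ z → π (punchIn x z) ≡ z
  π-punchIn z = trans (π-≢ (≢-sym (punchInᵢ≢i x z))) (punchOut-punchIn x)

  punchIn-π : ∀ {z} → x ≢ z → punchIn x (π z) ≡ z
  punchIn-π x≢z = trans (cong (punchIn x) (π-≢ x≢z)) (punchIn-punchOut x≢z)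

  π-fibres : ∀ {a b} → π a ≡ π b → a ≡ b ⊎ (a ≡ x × b ≡ y) ⊎ (a ≡ y × b ≡ x)
  π-fibres {a} {b} eq with x ≟ a | x ≟ b
  ... | yes refl | yes refl = inj₁ refl
  ... | yes refl | no x≢b = inj₂ (inj₁ (refl , sym (punchOut-injective x≢y x≢b eq)))
  ... | no x≢a | yes refl = inj₂ (inj₂ (punchOut-injective x≢a x≢y eq , refl))
  ... | no x≢a | no x≢b = inj₁ (punchOut-injective x≢a x≢b eq)

  -- Since `punchIn x` misses `x`, the merged vertex keeps the out-arcs of `y`, while arcs into `x`
  -- are redirected to it.
  out′ : Fin n → Fin 3 → Fin n
  out′ z i = π (out (punchIn x z) i)

  -- Two out-neighbours of a vertex are merged only if they are `x` and `y`.
  out′-inj : (∀ z → Inj (out z)) → (∀ {z} → Arc out z x → ¬ Arc out z y) → ∀ z → Inj (out′ z)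
  out′-inj out-inj no-common z {i} {j} eq with π-fibres eq
  ... | inj₁ eq′ = out-inj _ eq′
  ... | inj₂ (inj₁ (≡x , ≡y)) = contradiction (j , ≡y) (no-common (i , ≡x))
  ... | inj₂ (inj₂ (≡y , ≡x)) = contradiction (i , ≡y) (no-common (j , ≡x))

  -- The two sets are pulled back along `π`. Then `x` lies with `y` and uses the arc to `y`, while
  -- the other vertices use the arcs behind those of the contracted digraph.
  split⇒split : Arc out x y → Split (Arc out′) → Split (Arc out)
  split⇒split x⟶y (A , ((a , a∈A) , clA) , ((b , b∈∁A) , cl∁A)) =
    select P? ,
    ((punchIn x a , ∈-select⁺ P? (subst (_∈ A) (sym (π-punchIn a)) a∈A)) ,
     λ z∈ → let v , πv∈ , z⟶v = step clA (∈-select⁻ P? z∈) in v , ∈-select⁺ P? πv∈ , z⟶v) ,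
    ((punchIn x b , ∉-select⁺ P? (subst (_∉ A) (sym (π-punchIn b)) (x∈∁p⇒x∉p b∈∁A))) ,
     λ z∈ → let v , πv∈ , z⟶v = step cl∁A (x∉p⇒x∈∁p (∉-select⁻ P? z∈))
            in v , ∉-select⁺ P? (x∈∁p⇒x∉p πv∈) , z⟶v)
    where
    P? : Decidable (λ z → π z ∈ A)
    P? z = π z ∈? A
    step : ∀ {B} → Closed (Arc out′) B → ∀ {z} → π z ∈ B → ∃ λ v → π v ∈ B × Arc out z v
    step {B} clB {z} πz∈B with x ≟ z
    ... | yes refl = y , subst (_∈ B) (sym (π-≢ x≢y)) πz∈B , x⟶y
    ... | no x≢z = let v′ , v′∈B , i , eq = clB πz∈B in
      out (punchIn x (punchOut x≢z)) i , subst (_∈ B) (sym eq) v′∈B ,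
      i , cong (flip out i) (sym (punchIn-punchOut x≢z))

-- Induction on the number of vertices: an arc whose ends have no common in-neighbour is contracted,
-- giving a smaller unsplit digraph. The double negation suffices for refuting success.
thomassen : (out : Fin n → Fin 3 → Fin n) → Fin n → (∀ z → Inj (out z)) → ¬ ¬ Split (Arc out)
thomassen {n = suc n} out v₀ out-inj unsplit =
  common-in-neighbours⇒split out out-inj v₀ asym common unsplit
  where
  asym : ∀ {x y} → Arc out x y → ¬ Arc out y x
  asym x⟶y y⟶x = unsplit (two-cycle⇒split out out-inj x⟶y y⟶x)
  common : ∀ {x y} → Arc out x y → ∃ λ z → Arc out z x × Arc out z y
  common {x} {y} x⟶y = decidable-stable (any? λ z → arc? out z x ×-dec arc? out z y) λ none →
    let x≢y : x ≢ y
        x≢y = λ { refl → asym x⟶y x⟶y }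
        open Contraction out x≢y
    in thomassen out′ (π x)
         (out′-inj out-inj λ z⟶x z⟶y → none (_ , z⟶x , z⟶y))
         (unsplit ∘ split⇒split x⟶y)

-- Coalitions

module _ {R : Subset n} where

  combine-∈ : (σR σO : Profile n k) → ∀ {i} → i ∈ R → combine R σR σO i ≡ σR i
  combine-∈ σR σO {i} i∈R with i ∈? R
  ... | yes _ = refl
  ... | no i∉R = contradiction i∈R i∉R

  combine-∉ : (σR σO : Profile n k) → ∀ {i} → i ∉ R → combine R σR σO i ≡ σO i
  combine-∉ σR σO {i} i∉R with i ∈? R
  ... | yes i∈R = contradiction i∈R i∉R
  ... | no _ = refl

  -- Only outsiders are asked for a choice in `Q`: when `Q` is `R ⊆_`, a member has none, as it may
  -- not choose itself.
  respond : (Q : Pred (Subset n) 0ℓ) (σR : Profile n k) →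
    (∀ i → i ∉ R → ∃ λ (c : Choice n k i) → Q (proj₁ c)) →
    ∃ λ σO → ∀ {i} → i ∉ R → Q (chosen (combine R σR σO) i)
  respond {k} Q σR choose = σO , property
    where
    σO : Profile n k
    σO i with i ∈? R
    ... | yes _ = σR i
    ... | no i∉R = proj₁ (choose i i∉R)
    σO-Q : ∀ {i} → i ∉ R → Q (chosen σO i)
    σO-Q {i} i∉R with i ∈? R
    ... | yes i∈R = contradiction i∈R i∉R
    ... | no i∉R′ = proj₂ (choose i i∉R′)
    property : ∀ {i} → i ∉ R → Q (chosen (combine R σR σO) i)
    property i∉R = subst (Q ∘ proj₁) (sym (combine-∉ σR σO i∉R)) (σO-Q i∉R)

  -- Here `a` is an anchor whose label all members share. Stating this for any `S` that agrees with
  -- `σR` on `R` hides `combine`.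
  tied⇒successful : (σR : Profile n k) (a : Fin n) →
    (∀ S p → (∀ {i} → i ∈ R → S i ≡ chosen σR i) → Admissible S p →
      ∀ {i} → i ∈ R → p i ≡ p a) →
    SuccessfulCoalition n k R
  tied⇒successful σR a tied = σR , λ σO p adm i j i∈R j∈R →
    let tie = tied _ p (cong proj₁ ∘ combine-∈ σR σO) adm
    in trans (tie i∈R) (sym (tie j∈R))

-- Success for k ≤ 2

successful-0 : (R : Subset n) → SuccessfulCoalition n 0 R
successful-0 {n} R = (λ _ → ⊥ , ∣⊥∣≡0 n , ∉⊥) , λ σO p adm i j i∈R _ →
  -- The member `i` chose the empty set, so no partition is admissible.
  let l , l∈S , _ = adm i
      S≡⊥ = cong proj₁ (combine-∈ (λ _ → ⊥ , ∣⊥∣≡0 n , ∉⊥) σO i∈R)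
  in contradiction (subst (l ∈_) S≡⊥ l∈S) ∉⊥

successful-1 : (R : Subset n) {a b : Fin n} → a ≢ b → SuccessfulCoalition n 1 R
successful-1 {n} R {a} {b} a≢b = tied⇒successful σR a tied
  where
  σR : Profile n 1
  σR i with i ≟ a
  ... | yes refl = ⁅ b ⁆ , ∣⁅x⁆∣≡1 b , x≢y⇒x∉⁅y⁆ a≢b
  ... | no i≢a = ⁅ a ⁆ , ∣⁅x⁆∣≡1 a , x≢y⇒x∉⁅y⁆ i≢a
  tied : ∀ S p → (∀ {i} → i ∈ R → S i ≡ chosen σR i) → Admissible S p → ∀ {i} → i ∈ R → p i ≡ p a
  tied S p S≡ adm {i} i∈R with adm i | S≡ i∈R
  ... | l , l∈S , pl≡pi | eq with i ≟ a
  ...   | yes refl = refl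
  ...   | no _ = trans (sym pl≡pi) (cong p (x∈⁅y⁆⇒x≡y a (subst (l ∈_) eq l∈S)))

successful-2 : (R : Subset n) {a b c : Fin n} → a ∈ R → b ∈ R → a ≢ b → c ≢ a → c ≢ b →
  SuccessfulCoalition n 2 R
successful-2 {n} R {a} {b} {c} a∈R b∈R a≢b c≢a c≢b = tied⇒successful σR a tied
  where
  pair : (i {x y} : Fin n) → x ≢ y → i ≢ x → i ≢ y → Choice n 2 i
  pair i {x} {y} x≢y i≢x i≢y = ⁅ x ⁆ ∪ ⁅ y ⁆ , ∣⁅x⁆∪⁅y⁆∣≡2 x≢y , λ i∈ →
    [ x≢y⇒x∉⁅y⁆ i≢x , x≢y⇒x∉⁅y⁆ i≢y ]′ (x∈p∪q⁻ ⁅ x ⁆ ⁅ y ⁆ i∈)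
  σR : Profile n 2
  σR i with i ≟ a | i ≟ b
  ... | yes refl | _ = pair a (≢-sym c≢b) a≢b (≢-sym c≢a)
  ... | no _ | yes refl = pair b (≢-sym c≢a) (≢-sym a≢b) (≢-sym c≢b)
  ... | no i≢a | no i≢b = pair i a≢b i≢a i≢b
  σR-a : chosen σR a ≡ ⁅ b ⁆ ∪ ⁅ c ⁆
  σR-a with a ≟ a | a ≟ b
  ... | yes refl | _ = refl
  ... | no a≢a | _ = contradiction refl a≢a
  σR-b : chosen σR b ≡ ⁅ a ⁆ ∪ ⁅ c ⁆
  σR-b with b ≟ a | b ≟ b
  ... | yes b≡a | _ = contradiction (sym b≡a) a≢b
  ... | no _ | yes refl = refl
  ... | no _ | no b≢b = contradiction refl b≢b
  σR-≢ : ∀ {i} → i ≢ a → i ≢ b → chosen σR i ≡ ⁅ a ⁆ ∪ ⁅ b ⁆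
  σR-≢ {i} i≢a i≢b with i ≟ a | i ≟ b
  ... | yes i≡a | _ = contradiction i≡a i≢a
  ... | no _ | yes i≡b = contradiction i≡b i≢b
  ... | no _ | no _ = refl
  tied : ∀ S p → (∀ {i} → i ∈ R → S i ≡ chosen σR i) → Admissible S p → ∀ {i} → i ∈ R → p i ≡ p a
  tied S p S≡ adm {i} i∈R = tie
    where
    same-as : ∀ {i x y} → i ∈ R → chosen σR i ≡ ⁅ x ⁆ ∪ ⁅ y ⁆ → p i ≡ p x ⊎ p i ≡ p y
    same-as {i} {x} {y} i∈R eq =
      let l , l∈S , pl≡pi = adm i
      in case x∈p∪q⁻ ⁅ x ⁆ ⁅ y ⁆ (subst (l ∈_) (trans (S≡ i∈R) eq) l∈S) of λ where
        (inj₁ l∈) → inj₁ (trans (sym pl≡pi) (cong p (x∈⁅y⁆⇒x≡y x l∈)))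
        (inj₂ l∈) → inj₂ (trans (sym pl≡pi) (cong p (x∈⁅y⁆⇒x≡y y l∈)))
    -- Either one of `a` and `b` is tied directly to the other, or both are tied to `c`.
    pb≡pa : p b ≡ p a
    pb≡pa with same-as a∈R σR-a | same-as b∈R σR-b
    ... | inj₁ pa≡pb | _ = sym pa≡pb
    ... | inj₂ _ | inj₁ pb≡pa = pb≡pa
    ... | inj₂ pa≡pc | inj₂ pb≡pc = trans pb≡pc (sym pa≡pc)
    tie : p i ≡ p a
    tie with i ≟ a | i ≟ b
    ... | yes refl | _ = refl
    ... | no _ | yes refl = pb≡pa
    ... | no i≢a | no i≢b with same-as i∈R (σR-≢ i≢a i≢b)
    ...   | inj₁ pi≡pa = pi≡pa
    ...   | inj₂ pi≡pb = trans pi≡pb pb≡pa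

-- Failure for k ≥ 3

two-parts⇒¬same-part : {R : Subset n} (S : Fin n → Subset n) (A : Subset n) {a b : Fin n} →
  a ∈ R → a ∈ A → b ∈ R → b ∉ A →
  (∀ {i} → i ∈ A → ∃ λ l → l ∈ S i × l ∈ A) → (∀ {i} → i ∉ A → ∃ λ l → l ∈ S i × l ∉ A) →
  ∃ λ p → Admissible S p × ¬ SamePart R p
two-parts⇒¬same-part {n} S A {a} {b} a∈R a∈A b∈R b∉A stay stay′ = p , adm , λ same →
  b∉A (subst (_∈ A) (trans (sym (p-∈ a∈A)) (trans (same a b a∈R b∈R) (p-∉ b∉A))) a∈A)
  where
  -- The members `a` and `b` serve as labels; they differ since only `a` lies in `A`.
  p : Partition n
  p i with i ∈? A
  ... | yes _ = a
  ... | no _ = b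
  p-∈ : ∀ {i} → i ∈ A → p i ≡ a
  p-∈ {i} i∈A with i ∈? A
  ... | yes _ = refl
  ... | no i∉A = contradiction i∈A i∉A
  p-∉ : ∀ {i} → i ∉ A → p i ≡ b
  p-∉ {i} i∉A with i ∈? A
  ... | yes i∈A = contradiction i∈A i∉A
  ... | no _ = refl
  adm : Admissible S p
  adm j with j ∈? A
  ... | yes j∈A = let l , l∈S , l∈A = stay j∈A in l , l∈S , p-∈ l∈A
  ... | no j∉A = let l , l∈S , l∉A = stay′ j∉A in l , l∈S , p-∉ l∉A

module _ {R : Subset n} (3≤k : 3 ≤ k) where

  private
    3≤∣S∣ : (σ : Profile n k) → ∀ i → 3 ≤ ∣ chosen σ i ∣
    3≤∣S∣ σ i = subst (3 ≤_) (sym (proj₁ (proj₂ (σ i)))) 3≤k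

  ¬successful-large : Fin n → k ≤ ∣ R ∣ → ¬ SuccessfulCoalition n k R
  ¬successful-large v₀ k≤r (σR , success) = thomassen out v₀ out-inj λ where
      (A , (neA , clA) , (ne∁A , cl∁A)) →
        let a , a∈R , a∈A = meets-R neA clA
            b , b∈R , b∈∁A = meets-R ne∁A cl∁A
            p , adm , ¬same = two-parts⇒¬same-part S A a∈R a∈A b∈R (x∈∁p⇒x∉p b∈∁A)
              (λ {i} i∈A → let l , l∈A , i⟶l = clA i∈A in l , out⇒∈ i i⟶l , l∈A)
              (λ {i} i∉A → let l , l∈∁A , i⟶l = cl∁A (x∉p⇒x∈∁p i∉A) in
                l , out⇒∈ i i⟶l , x∈∁p⇒x∉p l∈∁A)
        in ¬same (success σO p adm)
    where
    choose : ∀ i → i ∉ R → ∃ λ (c : Choice n k i) → proj₁ c ⊆ R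
    choose i i∉R =
      let s , _ , s⊆R , eq = interpolate ⊥ R ⊥⊆ (subst (_≤ k) (sym (∣⊥∣≡0 n)) z≤n) k≤r
      in (s , eq , i∉R ∘ s⊆R) , s⊆R
    σO = proj₁ (respond (_⊆ R) σR choose)
    S = chosen (combine R σR σO)
    -- Any three elements of each choice give a digraph of out-degree exactly 3.
    three : ∀ i → ∃ λ (f : Fin 3 → Fin n) → Inj f × (∀ j → f j ∈ S i)
    three i = enumerate (S i) (3≤∣S∣ (combine R σR σO) i)
    out : Fin n → Fin 3 → Fin n
    out i = proj₁ (three i)
    out-inj : ∀ i → Inj (out i)
    out-inj i = proj₁ (proj₂ (three i))
    out⇒∈ : ∀ i {l} → Arc out i l → l ∈ S i
    out⇒∈ i (j , refl) = proj₂ (proj₂ (three i)) j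
    -- Outsiders choose inside `R`, so an arc from an outsider within `B` ends in `R`.
    meets-R : ∀ {B} → Nonempty B → Closed (Arc out) B → ∃ λ i → i ∈ R × i ∈ B
    meets-R (i , i∈B) clB with i ∈? R
    ... | yes i∈R = i , i∈R , i∈B
    ... | no i∉R = let l , l∈B , i⟶l = clB i∈B in
      l , proj₂ (respond (_⊆ R) σR choose) i∉R (out⇒∈ i i⟶l) , l∈B

  ¬successful-small : suc k ≤ n → ∀ {a b} → a ∈ R → b ∈ R → a ≢ b → ∣ R ∣ < k →
    ¬ SuccessfulCoalition n k R
  ¬successful-small k<n {a} {b} a∈R b∈R a≢b r<k (σR , success) =
    let p , adm , ¬same = two-parts⇒¬same-part S (select P?) a∈R (∈-select⁺ P? (inj₁ refl))
          b∈R ([ ≢-sym a≢b , b≢c ]′ ∘ ∈-select⁻ P?) stay stay′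
    in ¬same (success σO p adm)
    where
    choose : ∀ i → i ∉ R → ∃ λ (c : Choice n k i) → R ⊆ proj₁ c
    choose i i∉R =
      -- There is room for `k` elements other than `i` because `n ∸ 1 ≥ k`.
      let s , R⊆s , s⊆ , eq = interpolate R (∁ ⁅ i ⁆)
            (λ j∈R → x∉p⇒x∈∁p (x≢y⇒x∉⁅y⁆ λ { refl → i∉R j∈R }))
            (ℕ.<⇒≤ r<k)
            (subst (k ≤_) (sym (trans (∣∁p∣≡n∸∣p∣ ⁅ i ⁆) (cong (n ∸_) (∣⁅x⁆∣≡1 i))))
              (ℕ.∸-monoˡ-≤ 1 k<n))
      in (s , eq , λ i∈s → x∈∁p⇒x∉p (s⊆ i∈s) (x∈⁅x⁆ i)) , R⊆s
    σO = proj₁ (respond (R ⊆_) σR choose)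
    R⊆S : ∀ {i} → i ∉ R → R ⊆ chosen (combine R σR σO) i
    R⊆S = proj₂ (respond (R ⊆_) σR choose)
    S = chosen (combine R σR σO)
    -- As `R` has fewer than `k` elements, `a` chooses some outsider `c`, who in turn chooses all of
    -- `R` and hence `a`.
    beyond-R : ∃ λ c → c ∈ S a × c ∉ R
    beyond-R = ∣q∣<∣p∣⇒p⊈q (S a) R
      (subst (∣ R ∣ <_) (sym (proj₁ (proj₂ (combine R σR σO a)))) r<k)
    c = proj₁ beyond-R
    c∈Sa = proj₁ (proj₂ beyond-R)
    c∉R = proj₂ (proj₂ beyond-R)
    b≢c : b ≢ c
    b≢c b≡c = c∉R (subst (_∈ R) b≡c b∈R)
    P? : Decidable (λ i → i ≡ a ⊎ i ≡ c)
    P? i = (i ≟ a) ⊎-dec (i ≟ c)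
    stay : ∀ {i} → i ∈ select P? → ∃ λ l → l ∈ S i × l ∈ select P?
    stay i∈ with ∈-select⁻ P? i∈
    ... | inj₁ refl = c , c∈Sa , ∈-select⁺ P? (inj₂ refl)
    ... | inj₂ refl = a , R⊆S c∉R a∈R , ∈-select⁺ P? (inj₁ refl)
    stay′ : ∀ {i} → i ∉ select P? → ∃ λ l → l ∈ S i × l ∉ select P?
    stay′ {i} _ =
      let l , l∈S , l≢a , l≢c = avoid-two-in (S i) (3≤∣S∣ (combine R σR σO) i) a c
      in l , l∈S , [ l≢a , l≢c ]′ ∘ ∈-select⁻ P?

theorem5p1 : (n k : ℕ) → suc k ≤ n → (R : Subset n) → 2 ≤ ∣ R ∣ →
    ((k ≤ 2 → SuccessfulCoalition n k R) × (k ≥ 3 → ¬ SuccessfulCoalition n k R))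
theorem5p1 n k k<n R 2≤r with enumerate R 2≤r
... | f , f-inj , f∈R = positive k k<n , negative
  where
  a = f zero
  b = f (suc zero)
  a≢b : a ≢ b
  a≢b eq = case f-inj eq of λ ()
  positive : ∀ k → suc k ≤ n → k ≤ 2 → SuccessfulCoalition n k R
  positive 0 _ _ = successful-0 R
  positive 1 _ _ = successful-1 R a≢b
  positive 2 3≤n _ =
    -- For `k = 2` the bound `n ≥ k + 1` provides the third element.
    let c , _ , c≢a , c≢b = avoid-two-in ⊤ (subst (3 ≤_) (sym (∣⊤∣≡n n)) 3≤n) a b
    in successful-2 R (f∈R zero) (f∈R (suc zero)) a≢b c≢a c≢b
  positive (suc (suc (suc _))) _ (s≤s (s≤s ()))
  negative : k ≥ 3 → ¬ SuccessfulCoalition n k R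
  negative 3≤k with k ℕ.≤? ∣ R ∣
  ... | yes k≤r = ¬successful-large 3≤k a k≤r
  ... | no k≰r = ¬successful-small 3≤k k<n (f∈R zero) (f∈R (suc zero)) a≢b (ℕ.≰⇒> k≰r)
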